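{- Let $n\geq 4$ be an integer. Then $$t(n,n-1,n-2)\leq 2n-4.$$
   Context: All graphs are finite, undirected and simple. Let $G$ be a nontrivial connected graph of order $n$ (i.e. with $n$ vertices). An edge-coloring of $G$ is any assignment of colors to the edges (adjacent edges may receive the same color). A tree $T$ that is a subgraph of $G$ is a rainbow tree if no two edges of $T$ have the same color. For $S\subseteq V(G)$ with $|S|\geq 2$, a rainbow $S$-tree is a rainbow tree $T$ in $G$ with $S\subseteq V(T)$. For an integer $k$ with $2\leq k\leq n$, an edge-coloring of $G$ is a $k$-rainbow coloring if for every $k$-subset $S$ of $V(G)$ there exists a rainbow $S$-tree. The $k$-rainbow index $rx_k(G)$ is the minimum number of colors needed in a $k$-rainbow coloring of $G$. For integers $2\leq k\leq n$ and $2\leq\ell\leq n-1$, $t(n,k,\ell)$ denotes the minimum size (number of edges) of a connected graph $G$ of order $n$ with $rx_k(G)\leq \ell$ (when such a graph exists). -}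

module Defs where

open import Data.Fin.Base using (Fin)
open import Data.Fin.Properties using (_<?_)
open import Data.Fin.Subset using (Subset; _∈_; _⊆_; ∣_∣; Nonempty)
open import Data.Fin.Subset.Properties using (_∈?_)
open import Data.List.Base using (List; _∷_; _++_; [_]; length; filter; allFin; cartesianProduct)
open import Data.List.Relation.Unary.Linked using (Linked)
open import Data.List.Relation.Unary.Unique.Propositional using (Unique)
open import Data.Nat.Base using (ℕ; _≤_)
open import Data.Product.Base using (Σ-syntax; ∃-syntax; _×_; _,_)
open import Data.Sum.Base using (_⊎_)
open import Data.Vec.Base using (Vec; lookup)
open import Relation.Binary.Construct.Closure.ReflexiveTransitive using (Star)
open import Relation.Binary.PropositionalEquality using (_≡_)
open import Relation.Nullary using (¬_)
open import Relation.Nullary.Decidable using (_×-dec_)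

-- Neighbourhoods are stored as vectors of finite subsets rather than as a
-- function, so that graphs of a given order can be enumerated without
-- function extensionality.
record Graph (n : ℕ) : Set where
  field
    neighbours : Vec (Subset n) n

  Adj : Fin n → Fin n → Set
  Adj u v = v ∈ lookup neighbours u

  field
    symmetric : ∀ {u v} → Adj u v → Adj v u
    loopless  : ∀ {v} → ¬ Adj v v

open Graph public using (neighbours; Adj)

-- Each undirected edge {u , v} is listed once, with its smaller endpoint first.
edges : ∀ {n} → Graph n → List (Fin n × Fin n)
edges {n} G =
  filter (λ (u , v) → (u <? v) ×-dec (v ∈? lookup (neighbours G) u))
         (cartesianProduct (allFin n) (allFin n))

size : ∀ {n} → Graph n → ℕ
size G = length (edges G)

Connected : ∀ {n} → Graph n → Set
Connected G = ∀ u v → Star (Adj G) u v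

-- A cycle is a closed walk x , xs , x on at least three distinct vertices.
Acyclic : ∀ {n} → Graph n → Set
Acyclic {n} G = ∀ (x : Fin n) (xs : List (Fin n)) → 2 ≤ length xs →
  Unique (x ∷ xs) → ¬ Linked (Adj G) (x ∷ xs ++ [ x ])

-- The edge set is kept as a graph on all of Fin n whose edges have both
-- endpoints in `vertices`; the remaining elements of Fin n are not part of
-- the subgraph.  One endpoint suffices in `endpoint` since adjacency is symmetric.
record Subgraph {n : ℕ} (G : Graph n) : Set where
  field
    vertices : Subset n
    edgeSet  : Graph n
    endpoint : ∀ {u v} → Adj edgeSet u v → u ∈ vertices
    include  : ∀ {u v} → Adj edgeSet u v → Adj G u v

open Subgraph public

IsTree : ∀ {n} {G : Graph n} → Subgraph G → Set
IsTree T =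
  Nonempty (vertices T) ×
  (∀ {u v} → u ∈ vertices T → v ∈ vertices T → Star (Adj (edgeSet T)) u v) ×
  Acyclic (edgeSet T)

-- `color-sym` makes the color depend only on the undirected edge; no
-- properness condition is imposed.
record EdgeColoring {n : ℕ} (G : Graph n) (c : ℕ) : Set where
  field
    color     : ∀ {u v} → Adj G u v → Fin c
    color-sym : ∀ {u v} (p : Adj G u v) (q : Adj G v u) → color p ≡ color q

open EdgeColoring public

Rainbow : ∀ {n c} {G : Graph n} → EdgeColoring G c → Subgraph G → Set
Rainbow χ T = ∀ {u v x y} (p : Adj (edgeSet T) u v) (q : Adj (edgeSet T) x y) →
  color χ (include T p) ≡ color χ (include T q) →
  (u ≡ x × v ≡ y) ⊎ (u ≡ y × v ≡ x)

RainbowTree : ∀ {n c} {G : Graph n} → EdgeColoring G c → Subset n → Set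
RainbowTree {G = G} χ S =
  Σ[ T ∈ Subgraph G ] IsTree T × Rainbow χ T × S ⊆ vertices T

IsRainbowColoring : ∀ {n c} {G : Graph n} → ℕ → EdgeColoring G c → Set
IsRainbowColoring {n} k χ = ∀ (S : Subset n) → ∣ S ∣ ≡ k → RainbowTree χ S

IsMinimum : (ℕ → Set) → ℕ → Set
IsMinimum P m = P m × (∀ j → P j → m ≤ j)

-- IsRx k G r says rx_k(G) = r.
IsRx : ∀ {n} → ℕ → Graph n → ℕ → Set
IsRx k G = IsMinimum (λ c → Σ[ χ ∈ EdgeColoring G c ] IsRainbowColoring k χ)

-- IsT n k ℓ m says that t(n,k,ℓ) exists and equals m.
IsT : ℕ → ℕ → ℕ → ℕ → Set
IsT n k ℓ = IsMinimum λ e →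
  Σ[ G ∈ Graph n ] Connected G × (∃[ r ] IsRx k G r × r ≤ ℓ) × size G ≡ e

-- The minimum is exactly 2n − 4.  A rainbow tree containing V ∖ {x} needs
-- n − 2 colors; when only n − 2 are available it therefore uses all of them and
-- misses x.  Taking x to be an endpoint of an edge of color q, we see that q
-- occurs on a second edge, so there are at least 2(n − 2) edges.
--
-- The bound is attained by K_{2,n−2} with parts {a , b} and {leaf j}: color the
-- edge a–leaf j by j and the edge b–leaf j by ρ j, where ρ is injective without
-- fixed points.  If a or b is deleted, the star at the other one is a rainbow
-- tree.  If leaf i is deleted, the star at b misses exactly the color ρ i, which
-- is free to attach a at leaf (ρ i).

module Submission where

open import Defs
open import Data.Nat.Base using (ℕ; _≤_; _*_; _∸_)
open import Data.Product.Base using (∃-syntax; _×_)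

open import Data.Bool.Base using (Bool; true; false; if_then_else_)
import Data.Bool.Properties as Bool
open import Data.Fin.Base as Fin using (Fin; zero; suc; fromℕ; inject₁; toℕ)
open import Data.Fin.Properties as Fin
  using (injective⇒≤; fromℕ≢inject₁; inject₁-injective; toℕ-inject₁; ¬∀⟶∃¬)
open import Data.Fin.Subset as Subset using (Subset; ∣_∣; ⁅_⁆; ∁)
open import Data.Fin.Subset.Properties as Subset
  using (∣⁅x⁆∣≡1; ∣∁p∣≡n∸∣p∣; ∣⊤∣≡n; p⊆q⇒∣p∣≤∣q∣; x∈∁p⇒x∉p; x∉p⇒x∈∁p; x≢y⇒x∉⁅y⁆; x∈⁅x⁆)
open import Data.List.Base
  using (List; []; _∷_; _++_; [_]; length; allFin; map; lookup; cartesianProduct; cartesianProductWith)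
import Data.List.Membership.DecPropositional as DecPropositional
open import Data.List.Membership.Propositional using (_∈_; _∉_)
open import Data.List.Membership.Propositional.Properties
  using (∈-++⁺ˡ; ∈-++⁺ʳ; ∈-allFin; ∈-lookup; ∈-filter⁺; ∈-filter⁻; ∈-cartesianProduct⁺;
         ∈-cartesianProductWith⁻; ∈-map⁺)
open import Data.List.Properties using (length-++; length-map; length-tabulate)
open import Data.List.Relation.Unary.All as All using (All; []; _∷_)
open import Data.List.Relation.Unary.All.Properties using (¬Any⇒All¬)
open import Data.List.Relation.Unary.AllPairs using ([]; _∷_)
open import Data.List.Relation.Unary.Any as Any using (here; there)
open import Data.List.Relation.Unary.Any.Properties using (lookup-index)
open import Data.List.Relation.Unary.Linked as Linked using (Linked; _∷_)
open import Data.List.Relation.Unary.Unique.Propositional using (Unique)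
open import Data.List.Relation.Unary.Unique.Propositional.Properties
  using (allFin⁺; filter⁺; cartesianProduct⁺; cartesianProductWith⁺)
open import Data.Nat.Base using (zero; suc; _+_; _<_; z≤n; s≤s)
import Data.Nat.Properties as ℕ
open import Data.Nat.Induction using (<-wellFounded)
open import Induction.WellFounded using (Acc; acc)
open import Data.Product.Base using (Σ-syntax; ∃₂; _,_; proj₁; proj₂)
open import Data.Sum.Base using (_⊎_; inj₁; inj₂; [_,_]′; swap)
open import Data.Vec.Base as Vec using (tabulate)
open import Data.Vec.Properties using ([]=⇒lookup; lookup⇒[]=; lookup∘tabulate)
open import Function.Base using (_∘_; id)
open import Relation.Binary.Construct.Closure.ReflexiveTransitive using (Star; ε; _◅_; _◅◅_; reverse)
open import Relation.Binary.Core using (Rel)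
open import Relation.Binary.Definitions using (Decidable; Symmetric; tri<; tri≈; tri>)
open import Relation.Binary.PropositionalEquality
  using (_≡_; _≢_; refl; sym; trans; cong; cong₂; subst; ≢-sym)
open import Relation.Nullary using (¬_; Dec; yes; no; does; contradiction)
open import Relation.Nullary.Decidable using (_×-dec_; _⊎-dec_; ¬?; dec-true; decidable-stable)
open import Level using (0ℓ)

private
  variable
    A B C : Set
    n c : ℕ

open module DecMembership {n} = DecPropositional (Fin._≟_ {n}) using (_∈?_)

-- Counting with duplicate-free lists

lookup-injective : {xs : List A} → Unique xs → ∀ {i j} → lookup xs i ≡ lookup xs j → i ≡ j
lookup-injective (_ ∷ _)  {zero}  {zero}  _  = refl
lookup-injective (x ∷ _)  {zero}  {suc j} eq = contradiction eq (All.lookup x (∈-lookup j))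
lookup-injective (x ∷ _)  {suc i} {zero}  eq = contradiction (sym eq) (All.lookup x (∈-lookup i))
lookup-injective (_ ∷ xs) {suc i} {suc j} eq = cong suc (lookup-injective xs eq)

-- Pigeonhole: sending each position in `xs` to a position of the same entry in `ys` is injective,
-- because an entry determines its position in `xs`.
unique-⊆⇒length≤ : {xs ys : List A} → Unique xs → (∀ {x} → x ∈ xs → x ∈ ys) → length xs ≤ length ys
unique-⊆⇒length≤ {xs = xs} {ys} uniq sub = injective⇒≤ {f = Any.index ∘ position} λ {i} {j} eq →
  lookup-injective uniq
    (trans (lookup-index (position i))
      (trans (cong (lookup ys) eq) (sym (lookup-index (position j)))))
  where
  position : ∀ i → lookup xs i ∈ ys
  position i = sub (∈-lookup i)

length-allFin : ∀ n → length (allFin n) ≡ n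
length-allFin n = length-tabulate id

unique⇒length≤ : {xs : List (Fin n)} → Unique xs → length xs ≤ n
unique⇒length≤ {n} {xs} uniq = subst (length xs ≤_) (length-allFin n) (unique-⊆⇒length≤ uniq λ {x} _ → ∈-allFin x)

unique-∷ : {x : A} {xs : List A} → x ∉ xs → Unique xs → Unique (x ∷ xs)
unique-∷ x∉xs uniq = ¬Any⇒All¬ _ x∉xs ∷ uniq

unique-full : {xs : List (Fin n)} → Unique xs → length xs ≡ n → ∀ x → x ∈ xs
unique-full {n} {xs} uniq eq x = decidable-stable (x ∈? xs) λ x∉xs →
  ℕ.1+n≰n (subst (λ l → suc l ≤ n) eq (unique⇒length≤ (unique-∷ x∉xs uniq)))

outsider : (xs : List (Fin n)) → length xs < n → ∃[ x ] x ∉ xs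
outsider {n} xs short = ¬∀⟶∃¬ n (_∈ xs) (_∈? xs) λ all →
  ℕ.<⇒≱ short (subst (_≤ length xs) (length-allFin n) (unique-⊆⇒length≤ (allFin⁺ n) λ {x} _ → all x))

length-cartesianProductWith : (f : A → B → C) (xs : List A) (ys : List B) →
  length (cartesianProductWith f xs ys) ≡ length xs * length ys
length-cartesianProductWith f []       ys = refl
length-cartesianProductWith f (x ∷ xs) ys = trans (length-++ (map (f x) ys))
  (cong₂ _+_ (length-map (f x) ys) (length-cartesianProductWith f xs ys))

-- Vertex sets missing one vertex.

∣∁⁅x⁆∣≡n∸1 : (x : Fin n) → ∣ ∁ ⁅ x ⁆ ∣ ≡ n ∸ 1
∣∁⁅x⁆∣≡n∸1 {n} x = trans (∣∁p∣≡n∸∣p∣ ⁅ x ⁆) (cong (n ∸_) (∣⁅x⁆∣≡1 x))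

∈∁⁅⁆⁺ : {x y : Fin n} → y ≢ x → y Subset.∈ ∁ ⁅ x ⁆
∈∁⁅⁆⁺ y≢x = x∉p⇒x∈∁p (x≢y⇒x∉⁅y⁆ y≢x)

∈∁⁅⁆⁻ : {x y : Fin n} → y Subset.∈ ∁ ⁅ x ⁆ → y ≢ x
∈∁⁅⁆⁻ y∈ refl = x∈∁p⇒x∉p y∈ (x∈⁅x⁆ _)

∈∉⇒≢ : {x y : Fin n} {S : Subset n} → y Subset.∈ S → x Subset.∉ S → y ≢ x
∈∉⇒≢ y∈ x∉ refl = x∉ y∈

-- This reduces rainbow trees for arbitrary proper vertex sets to those for complements of single
-- vertices.
⊆∁⁅⁆ : (S : Subset n) → ∣ S ∣ < n → ∃[ x ] S Subset.⊆ ∁ ⁅ x ⁆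
⊆∁⁅⁆ {n} S small with ¬∀⟶∃¬ n (Subset._∈ S) (Subset._∈? S) (λ all →
  ℕ.<⇒≱ small (subst (_≤ ∣ S ∣) (∣⊤∣≡n n) (p⊆q⇒∣p∣≤∣q∣ {p = Subset.⊤} λ {x} _ → all x)))
... | x , x∉S = x , λ y∈S → ∈∁⁅⁆⁺ λ { refl → x∉S y∈S }

-- The edge list of a graph.

module _ (G : Graph n) where

  isEdge? : (e : Fin n × Fin n) → Dec (proj₁ e Fin.< proj₂ e × Adj G (proj₁ e) (proj₂ e))
  isEdge? (u , v) = (u Fin.<? v) ×-dec (v Subset.∈? Vec.lookup (neighbours G) u)

  ∈edges⁺ : ∀ {u v} → u Fin.< v → Adj G u v → (u , v) ∈ edges G
  ∈edges⁺ u<v p = ∈-filter⁺ isEdge? (∈-cartesianProduct⁺ (∈-allFin _) (∈-allFin _)) (u<v , p)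

  ∈edges⁻ : ∀ {u v} → (u , v) ∈ edges G → u Fin.< v × Adj G u v
  ∈edges⁻ e∈ = proj₂ (∈-filter⁻ isEdge? {xs = cartesianProduct (allFin n) (allFin n)} e∈)

  edges-unique : Unique (edges G)
  edges-unique = filter⁺ isEdge? (cartesianProduct⁺ (allFin⁺ n) (allFin⁺ n))

-- Lower bound

-- Follow the walk up to the first step that leaves `U`.
crossing : {R : Rel (Fin n) 0ℓ} {u v : Fin n} (U : List (Fin n)) → Star R u v → u ∈ U → v ∉ U →
  ∃₂ λ x y → R x y × x ∈ U × y ∉ U
crossing U ε u∈U v∉U = contradiction u∈U v∉U
crossing U (_◅_ {j = w} e walk) u∈U v∉U with w ∈? U
... | yes w∈U = crossing U walk w∈U v∉U
... | no  w∉U = _ , _ , e , u∈U , w∉U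

module _ {G : Graph n} (χ : EdgeColoring G c) where

  -- Both colors agree with the color of the reversed edge.
  color-irrelevant : ∀ {u v} (p q : Adj G u v) → color χ p ≡ color χ q
  color-irrelevant p q =
    trans (color-sym χ p (Graph.symmetric G p)) (sym (color-sym χ q (Graph.symmetric G p)))

  module _ (T : Subgraph G) (tree : IsTree T) (rainbow : Rainbow χ T) where

    -- A part of T grown from a single vertex: an edge of T leaving `reached` has a
    -- color outside `colors`, since those already occur on other edges of T.
    record Grown (m : ℕ) : Set where
      field
        reached        : List (Fin n)
        colors         : List (Fin c)
        root           : Fin n
        root∈          : root ∈ reached
        reached-length : length reached ≡ suc m
        colors-length  : length colors ≡ m
        colors-unique  : Unique colors
        reached⊆       : ∀ {v} → v ∈ reached → v Subset.∈ vertices T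
        used           : ∀ {q} → q ∈ colors → ∃₂ λ u v → Σ[ p ∈ Adj (edgeSet T) u v ]
                           u ∈ reached × v ∈ reached × color χ (include T p) ≡ q

    open Grown

    -- Here `missing` lists the only vertices that `T` may fail to contain. As long as `reached` and
    -- `missing` together do not exhaust the graph, `T` has an unreached vertex, and the path to it
    -- inside `T` supplies the next edge.
    grow : (missing : List (Fin n)) → (∀ v → v ∉ missing → v Subset.∈ vertices T) →
           ∀ m → m + length missing < n → Grown m
    grow missing cover zero _ = let (r , r∈T) , _ = tree in record
      { reached        = [ r ]
      ; colors         = []
      ; root           = r
      ; root∈          = here refl
      ; reached-length = refl
      ; colors-length  = refl
      ; colors-unique  = []
      ; reached⊆       = λ { (here refl) → r∈T }
      ; used           = λ ()
      }
    grow missing cover (suc m) bound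
      with g ← grow missing cover m (ℕ.<-trans (ℕ.n<1+n _) bound)
      -- After `m` steps `suc m` vertices are reached, so `bound` says exactly that
      -- `reached g ++ missing` is shorter than `n`.
      with v , v∉ ← outsider (reached g ++ missing)
             (subst (_< n) (sym (trans (length-++ (reached g)) (cong (_+ _) (reached-length g)))) bound)
      with x , y , p , x∈ , y∉ ← crossing (reached g)
             (proj₁ (proj₂ tree) (reached⊆ g (root∈ g)) (cover v (v∉ ∘ ∈-++⁺ʳ (reached g))))
             (root∈ g) (v∉ ∘ ∈-++⁺ˡ)
      = record
      { reached        = y ∷ reached g
      ; colors         = color χ (include T p) ∷ colors g
      ; root           = root g
      ; root∈          = there (root∈ g)
      ; reached-length = cong suc (reached-length g)
      ; colors-length  = cong suc (colors-length g)
      ; colors-unique  = unique-∷ fresh (colors-unique g)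
      ; reached⊆       = λ { (here refl) → endpoint T (Graph.symmetric (edgeSet T) p)
                           ; (there w∈)  → reached⊆ g w∈ }
      ; used           = λ { (here refl) → x , y , p , there x∈ , here refl , refl
                           ; (there q∈)  → let u , v , p′ , u∈ , v∈ , eq = used g q∈
                                           in u , v , p′ , there u∈ , there v∈ , eq }
      }
      where
      -- A repeated color would identify the new edge with one inside `reached`, but `y` lies
      -- outside.
      fresh : color χ (include T p) ∉ colors g
      fresh q∈ with _ , _ , p′ , u∈ , v∈ , eq ← used g q∈ | rainbow p p′ (sym eq)
      ... | inj₁ (refl , refl) = y∉ v∈
      ... | inj₂ (refl , refl) = y∉ u∈

    colors≥ : ∀ {m} → Grown m → m ≤ c
    colors≥ g = subst (_≤ c) (colors-length g) (unique⇒length≤ (colors-unique g))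

    -- With `c ≤ m`, the `m` distinct colors collected by the growth exhaust all of `Fin c`.
    every-color-used : ∀ {m} → c ≤ m → Grown m → ∀ q → ∃₂ λ u v → Σ[ p ∈ Adj (edgeSet T) u v ]
      u Subset.∈ vertices T × v Subset.∈ vertices T × color χ (include T p) ≡ q
    every-color-used c≤m g q =
      let u , v , p , u∈ , v∈ , eq = used g (unique-full (colors-unique g)
            (trans (colors-length g) (ℕ.≤-antisym (colors≥ g) c≤m)) q)
      in u , v , p , reached⊆ g u∈ , reached⊆ g v∈ , eq

    module _ {x : Fin n} (covers : ∁ ⁅ x ⁆ Subset.⊆ vertices T) where

      -- Since `x` may lie outside `T`, the growth is guaranteed only up to `n ∸ 2` edges; `growAll`
      -- gains one more when `x` belongs to `T`.
      growAvoiding : ∀ {m} → suc m < n → Grown m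
      growAvoiding {m} bound = grow [ x ] (λ v v∉ → covers (∈∁⁅⁆⁺ (v∉ ∘ here))) m
        (subst (_< n) (ℕ.+-comm 1 m) bound)

      growAll : x Subset.∈ vertices T → ∀ {m} → m < n → Grown m
      growAll x∈ {m} bound = grow [] (λ v _ → everything v) m
        (subst (_< n) (sym (ℕ.+-identityʳ m)) bound)
        where
        everything : ∀ v → v Subset.∈ vertices T
        everything v with v Fin.≟ x
        ... | yes refl = x∈
        ... | no  v≢x  = covers (∈∁⁅⁆⁺ v≢x)

-- Two edges of every color.

module _ {G : Graph n} (χ : EdgeColoring G c) where

  -- The smaller endpoint comes first, as in `edges`, so equal edges have equal `ends`.
  record EdgeAvoiding (x : Fin n) (q : Fin c) : Set where
    constructor edge
    field
      {source target} : Fin n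
      ordered         : source Fin.< target
      adjacent        : Adj G source target
      colored         : color χ adjacent ≡ q
      source≢         : source ≢ x
      target≢         : target ≢ x

    ends : Fin n × Fin n
    ends = source , target

  open EdgeAvoiding

  orient : ∀ {x q u v} (p : Adj G u v) → u ≢ x → v ≢ x → color χ p ≡ q → EdgeAvoiding x q
  orient {u = u} {v} p u≢ v≢ eq with Fin.<-cmp u v
  ... | tri< u<v _ _  = edge u<v p eq u≢ v≢
  ... | tri≈ _ refl _ = contradiction p (Graph.loopless G)
  ... | tri> _ _ v<u  = edge v<u (Graph.symmetric G p) (trans (color-sym χ _ _) eq) v≢ u≢

  ends∈edges : ∀ {x q} (e : EdgeAvoiding x q) → ends e ∈ edges G
  ends∈edges e = ∈edges⁺ G (ordered e) (adjacent e)

  ends-determine-color : ∀ {x x′ q q′} (e : EdgeAvoiding x q) (e′ : EdgeAvoiding x′ q′) →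
    ends e ≡ ends e′ → q ≡ q′
  ends-determine-color (edge _ p refl _ _) (edge _ p′ refl _ _) refl = color-irrelevant χ p p′

  module _ (x₀ : Fin n) (edgeAvoiding : ∀ x q → EdgeAvoiding x q) where

    firstEdge : ∀ q → EdgeAvoiding x₀ q
    firstEdge = edgeAvoiding x₀

    -- Avoiding the source of the first edge of color `q` forces a different edge of the same color.
    secondEdge : ∀ q → EdgeAvoiding (source (firstEdge q)) q
    secondEdge q = edgeAvoiding (source (firstEdge q)) q

    edgeOf : Fin c → Bool → Fin n × Fin n
    edgeOf q true  = ends (firstEdge q)
    edgeOf q false = ends (secondEdge q)

    edgeOf∈edges : ∀ q b → edgeOf q b ∈ edges G
    edgeOf∈edges q true  = ends∈edges (firstEdge q)
    edgeOf∈edges q false = ends∈edges (secondEdge q)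

    -- An edge has only one color, so `q` and `q′` agree; the two edges chosen for one color differ
    -- because the second avoids the source of the first.
    edgeOf-injective : ∀ {q q′ b b′} → edgeOf q b ≡ edgeOf q′ b′ → q ≡ q′ × b ≡ b′
    edgeOf-injective {q} {q′} {true} {true} eq =
      ends-determine-color (firstEdge q) (firstEdge q′) eq , refl
    edgeOf-injective {q} {q′} {true} {false} eq
      with refl ← ends-determine-color (firstEdge q) (secondEdge q′) eq =
      contradiction (sym (cong proj₁ eq)) (source≢ (secondEdge q))
    edgeOf-injective {q} {q′} {false} {true} eq
      with refl ← ends-determine-color (secondEdge q) (firstEdge q′) eq =
      contradiction (cong proj₁ eq) (source≢ (secondEdge q))
    edgeOf-injective {q} {q′} {false} {false} eq =
      ends-determine-color (secondEdge q) (secondEdge q′) eq , refl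

    2·colors≤size : c * 2 ≤ size G
    2·colors≤size = begin
      c * 2
        ≡⟨ cong (_* 2) (length-allFin c) ⟨
      length (allFin c) * 2
        ≡⟨ length-cartesianProductWith edgeOf (allFin c) bools ⟨
      length (cartesianProductWith edgeOf (allFin c) bools)
        ≤⟨ unique-⊆⇒length≤
             (cartesianProductWith⁺ edgeOf edgeOf-injective (allFin⁺ c) (((λ ()) ∷ []) ∷ [] ∷ []))
             listed ⟩
      size G
        ∎
      where
      open ℕ.≤-Reasoning

      bools : List Bool
      bools = true ∷ false ∷ []

      listed : ∀ {e} → e ∈ cartesianProductWith edgeOf (allFin c) bools → e ∈ edges G
      listed e∈ with q , b , _ , _ , refl ← ∈-cartesianProductWith⁻ edgeOf (allFin c) bools e∈ =
        edgeOf∈edges q b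

-- Colors and edges forced by a rainbow coloring of order `2 + k`.

module _ {k : ℕ} {G : Graph (2 + k)} (χ : EdgeColoring G c) (χ-rainbow : IsRainbowColoring (1 + k) χ) where

  treeAvoiding : ∀ x → RainbowTree χ (∁ ⁅ x ⁆)
  treeAvoiding x = χ-rainbow (∁ ⁅ x ⁆) (∣∁⁅x⁆∣≡n∸1 x)

  rainbow⇒colors≥ : k ≤ c
  rainbow⇒colors≥ with treeAvoiding zero
  ... | T , tree , rainbow , covers =
    -- `ℕ.≤-refl` fixes the number of growth steps at `k`, two less than the order.
    colors≥ χ T tree rainbow (growAvoiding χ T tree rainbow {x = zero} covers ℕ.≤-refl)

  module _ (few : c ≤ k) where

    -- The rainbow tree for the complement of `x` already needs `k` colors, hence uses every one of
    -- them. Since it misses `x`, its edge of color `q` avoids `x`.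
    edgeAvoiding : ∀ x q → EdgeAvoiding χ x q
    edgeAvoiding x q with treeAvoiding x
    ... | T , tree , rainbow , covers =
      let _ , _ , p , u∈ , v∈ , eq =
            every-color-used χ T tree rainbow few (growAvoiding χ T tree rainbow {x = x} covers ℕ.≤-refl) q
      in orient χ (include T p) (∈∉⇒≢ u∈ x∉) (∈∉⇒≢ v∈ x∉) eq
      where
      x∉ : x Subset.∉ vertices T
      -- A tree containing `x` as well would span the graph and need `suc k` colors.
      x∉ x∈ = ℕ.<⇒≱ (s≤s few) (colors≥ χ T tree rainbow (growAll χ T tree rainbow {x = x} covers x∈ ℕ.≤-refl))

    rainbow⇒size≥ : k * 2 ≤ size G
    rainbow⇒size≥ = ℕ.≤-trans (ℕ.*-monoˡ-≤ 2 rainbow⇒colors≥) (2·colors≤size χ zero edgeAvoiding)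

-- Rooted rainbow trees

module FromRelation {R : Rel (Fin n) 0ℓ} (R? : Decidable R)
  (R-sym : Symmetric R) (R-irrefl : ∀ {v} → ¬ R v v) where

  rows : Vec.Vec (Subset n) n
  rows = tabulate λ u → tabulate λ v → does (R? u v)

  row-entry : ∀ u v → Vec.lookup (Vec.lookup rows u) v ≡ does (R? u v)
  row-entry u v = trans (cong (λ row → Vec.lookup row v) (lookup∘tabulate _ u)) (lookup∘tabulate _ v)

  ∈row⁻ : ∀ {u v} → v Subset.∈ Vec.lookup rows u → R u v
  ∈row⁻ {u} {v} v∈ with R? u v | trans (sym (row-entry u v)) ([]=⇒lookup v∈)
  ... | yes r | _ = r

  ∈row⁺ : ∀ {u v} → R u v → v Subset.∈ Vec.lookup rows u
  ∈row⁺ {u} {v} r = lookup⇒[]= v _ (trans (row-entry u v) (dec-true (R? u v) r))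

  graph : Graph n
  graph = record
    { neighbours = rows
    ; symmetric  = ∈row⁺ ∘ R-sym ∘ ∈row⁻
    ; loopless   = R-irrefl ∘ ∈row⁻
    }

-- A tree on all vertices but `removed`, given by a parent relation. The strictly decreasing `rank`
-- gives termination of the way to the root and excludes cycles; since parents are unique, an edge
-- is identified by its child, and `rainbow` need only separate children.
module RootedTree {G : Graph n} (χ : EdgeColoring G c) (removed root : Fin n)
  {Parent     : Rel (Fin n) 0ℓ}
  (parent?    : Decidable Parent)
  (functional : ∀ {u v w} → Parent u v → Parent u w → v ≡ w)
  (rank       : Fin n → ℕ)
  (descends   : ∀ {u v} → Parent u v → rank v < rank u)
  (root≢      : root ≢ removed)
  (child≢     : ∀ {u v} → Parent u v → u ≢ removed)
  (parent≢    : ∀ {u v} → Parent u v → v ≢ removed)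
  (orphan     : ∀ {u} → u ≢ removed → u ≡ root ⊎ ∃[ v ] Parent u v)
  (adj        : ∀ {u v} → Parent u v → Adj G u v)
  (rainbow    : ∀ {u v x y} (p : Parent u v) (q : Parent x y) →
                color χ (adj p) ≡ color χ (adj q) → u ≡ x)
  where

  S : Subset n
  S = ∁ ⁅ removed ⁆

  Edge : Rel (Fin n) 0ℓ
  Edge u v = Parent u v ⊎ Parent v u

  open FromRelation {R = Edge} (λ u v → parent? u v ⊎-dec parent? v u)
    swap (λ e → ℕ.<-irrefl refl ([ descends , descends ]′ e))

  tree : Subgraph G
  tree = record
    { vertices = S
    ; edgeSet  = graph
    ; endpoint = λ p → ∈∁⁅⁆⁺ ([ child≢ , parent≢ ]′ (∈row⁻ p))
    ; include  = λ p → [ adj , Graph.symmetric G ∘ adj ]′ (∈row⁻ p)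
    }

  toRoot : ∀ {u} → Acc _<_ (rank u) → u Subset.∈ S → Star (Adj graph) u root
  toRoot (acc rec) u∈ with orphan (∈∁⁅⁆⁻ u∈)
  ... | inj₁ refl    = ε
  ... | inj₂ (v , p) = ∈row⁺ (inj₁ p) ◅ toRoot (rec (descends p)) (∈∁⁅⁆⁺ (parent≢ p))

  connected : ∀ {u v} → u Subset.∈ S → v Subset.∈ S → Star (Adj graph) u v
  connected u∈ v∈ =
    toRoot (<-wellFounded _) u∈ ◅◅ reverse (Graph.symmetric graph) (toRoot (<-wellFounded _) v∈)

  -- A walk without backtracking that has once moved away from the root does so forever.
  downward : ∀ {t x y} zs → Parent y x → Linked Edge (y ∷ zs ++ [ t ]) →
    Unique (t ∷ x ∷ y ∷ zs) → ∃[ w ] w ∈ y ∷ zs × Parent t w × rank y < rank t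
  downward [] p (inj₁ q ∷ _) ((t≢x ∷ _) ∷ _) = contradiction (functional q p) t≢x
  downward [] p (inj₂ q ∷ _) _ = _ , here refl , q , descends q
  downward (z ∷ zs) p (inj₁ q ∷ _) (_ ∷ (_ ∷ x≢z ∷ _) ∷ _) = contradiction (functional p q) x≢z
  downward (z ∷ zs) p (inj₂ q ∷ walk) ((_ ∷ t≢) ∷ _ ∷ uniq)
    with w , w∈ , r , lt ← downward zs q walk (t≢ ∷ uniq) = w , there w∈ , r , ℕ.<-trans (descends q) lt

  -- The walk climbs towards the root until it first turns downward, and then `downward` takes over.
  -- Its last step must arrive at `t` from the parent of `t`, since `rank` stays below that of `t`
  -- while climbing.
  upward : ∀ {t y} zs → rank y < rank t → Linked Edge (y ∷ zs ++ [ t ]) →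
    Unique (t ∷ y ∷ zs) → ∃[ w ] w ∈ y ∷ zs × Parent t w
  upward [] lt (inj₁ q ∷ _) _ = contradiction (descends q) (ℕ.<-asym lt)
  upward [] lt (inj₂ q ∷ _) _ = _ , here refl , q
  upward (z ∷ zs) lt (inj₁ q ∷ walk) ((_ ∷ t≢) ∷ _ ∷ uniq)
    with w , w∈ , r ← upward zs (ℕ.<-trans (descends q) lt) walk (t≢ ∷ uniq) = w , there w∈ , r
  upward (z ∷ zs) lt (inj₂ q ∷ walk) uniq
    with w , w∈ , r , _ ← downward zs q walk uniq = w , there w∈ , r

  -- If the first step goes from `t` to its parent, the closing step comes from that same parent,
  -- which would then occur twice. If it goes to a child, turning back at once returns to `t`, and
  -- continuing downward raises the rank for good.
  no-cycle : ∀ x xs → 2 ≤ length xs → Unique (x ∷ xs) → ¬ Linked Edge (x ∷ xs ++ [ x ])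
  no-cycle t (y ∷ z ∷ zs) _ ((_ ∷ t≢) ∷ y≢ ∷ uniq) (inj₁ p ∷ inj₁ q ∷ walk)
    with w , w∈ , r ← upward zs (ℕ.<-trans (descends q) (descends p)) walk (t≢ ∷ uniq) =
    All.lookup y≢ w∈ (functional p r)
  no-cycle t (y ∷ z ∷ zs) _ uniq@(_ ∷ y≢ ∷ _) (inj₁ p ∷ inj₂ q ∷ walk)
    with w , w∈ , r , _ ← downward zs q walk uniq = All.lookup y≢ w∈ (functional p r)
  no-cycle t (y ∷ z ∷ zs) _ ((_ ∷ t≢z ∷ _) ∷ _) (inj₂ p ∷ inj₁ q ∷ walk) = t≢z (functional p q)
  no-cycle t (y ∷ z ∷ zs) _ uniq (inj₂ p ∷ inj₂ q ∷ walk)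
    with _ , _ , _ , lt ← downward zs q walk uniq =
    ℕ.<-asym lt (ℕ.<-trans (descends p) (descends q))
  no-cycle t (y ∷ []) (s≤s ()) _ _

  isTree : IsTree tree
  isTree = (root , ∈∁⁅⁆⁺ root≢) , connected , λ x xs long uniq walk → no-cycle x xs long uniq (Linked.map ∈row⁻ walk)

  isRainbow : Rainbow χ tree
  isRainbow p q eq = go (∈row⁻ p) (∈row⁻ q)
    (trans (color-symmetric (∈row⁻ p)) (trans eq (sym (color-symmetric (∈row⁻ q)))))
    where
    include′ : ∀ {u v} → Edge u v → Adj G u v
    include′ = [ adj , Graph.symmetric G ∘ adj ]′

    -- Every edge is read from child to parent, the direction in which `rainbow` compares colors.
    childColor : ∀ {u v} → Edge u v → Fin _
    childColor = [ (λ p → color χ (adj p)) , (λ p → color χ (adj p)) ]′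

    color-symmetric : ∀ {u v} (e : Edge u v) → childColor e ≡ color χ (include′ e)
    color-symmetric (inj₁ p) = refl
    color-symmetric (inj₂ p) = color-sym χ _ _

    go : ∀ {u v x y} (e : Edge u v) (f : Edge x y) → childColor e ≡ childColor f →
         (u ≡ x × v ≡ y) ⊎ (u ≡ y × v ≡ x)
    go (inj₁ p) (inj₁ q) eq with refl ← rainbow p q eq = inj₁ (refl , functional p q)
    go (inj₁ p) (inj₂ q) eq with refl ← rainbow p q eq = inj₂ (refl , functional p q)
    go (inj₂ p) (inj₁ q) eq with refl ← rainbow p q eq = inj₂ (functional p q , refl)
    go (inj₂ p) (inj₂ q) eq with refl ← rainbow p q eq = inj₁ (functional p q , refl)

  rainbowTree : RainbowTree χ S
  rainbowTree = tree , isTree , isRainbow , id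

-- The extremal graph

-- The cyclic shift by minus one.
ρ : Fin (suc n) → Fin (suc n)
ρ {n} zero    = fromℕ n
ρ     (suc j) = inject₁ j

ρ-injective : {i j : Fin (suc n)} → ρ i ≡ ρ j → i ≡ j
ρ-injective {i = zero}  {zero}  _  = refl
ρ-injective {i = zero}  {suc j} eq = contradiction eq fromℕ≢inject₁
ρ-injective {i = suc i} {zero}  eq = contradiction (sym eq) fromℕ≢inject₁
ρ-injective {i = suc i} {suc j} eq = cong suc (inject₁-injective eq)

ρ-derangement : (i : Fin (2 + n)) → ρ i ≢ i
ρ-derangement zero    ()
ρ-derangement (suc j) eq = ℕ.1+n≢n (trans (cong toℕ (sym eq)) (toℕ-inject₁ j))

module Extremal (m : ℕ) where

  k : ℕ
  k = 2 + m

  Vertex : Set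
  Vertex = Fin (2 + k)

  pattern a      = zero
  pattern b      = suc zero
  pattern leaf j = suc (suc j)

  -- Adjacency in `K` means different values here, which makes `K` complete bipartite.
  isHub : Vertex → Bool
  isHub a        = true
  isHub b        = true
  isHub (leaf _) = false

  open FromRelation {R = λ u v → isHub u ≢ isHub v} (λ u v → ¬? (isHub u Bool.≟ isHub v))
    ≢-sym (λ ne → ne refl) public renaming (graph to K; ∈row⁺ to adj⁺; ∈row⁻ to adj⁻)

  -- The value on pairs of non-adjacent vertices is irrelevant.
  col : Vertex → Vertex → Fin k
  col a        (leaf j) = j
  col (leaf j) a        = j
  col b        (leaf j) = ρ j
  col (leaf j) b        = ρ j
  col _        _        = zero

  col-sym : ∀ u v → col u v ≡ col v u
  col-sym a        a        = refl
  col-sym a        b        = refl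
  col-sym a        (leaf _) = refl
  col-sym b        a        = refl
  col-sym b        b        = refl
  col-sym b        (leaf _) = refl
  col-sym (leaf _) a        = refl
  col-sym (leaf _) b        = refl
  col-sym (leaf _) (leaf _) = refl

  χ : EdgeColoring K k
  χ = record { color = λ {u} {v} _ → col u v ; color-sym = λ {u} {v} _ _ → col-sym u v }

  connected : Connected K
  connected u v = toA u ◅◅ reverse (Graph.symmetric K) (toA v)
    where
    toA : ∀ u → Star (Adj K) u a
    toA a        = ε
    toA b        = adj⁺ {b} {leaf zero} (λ ()) ◅ adj⁺ {leaf zero} {a} (λ ()) ◅ ε
    toA (leaf j) = adj⁺ {leaf j} {a} (λ ()) ◅ ε

  -- One construction serves both deleted hubs: the spokes at `hub` have distinct colors by
  -- `col-injective`.
  module StarTree (hub other : Vertex) (isHub-hub : isHub hub ≡ true) (isHub-other : isHub other ≡ true)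
    (hub≢other : hub ≢ other) (hubs : ∀ {u} → isHub u ≡ true → u ≢ other → u ≡ hub)
    (col-injective : ∀ {i j} → col (leaf i) hub ≡ col (leaf j) hub → i ≡ j) where

    Parent : Vertex → Vertex → Set
    Parent u v = isHub u ≡ false × v ≡ hub

    parent? : Decidable Parent
    parent? u v = (isHub u Bool.≟ false) ×-dec (v Fin.≟ hub)

    rank : Vertex → ℕ
    rank u = if isHub u then 0 else 1

    descends : ∀ {u v} → Parent u v → rank v < rank u
    descends (u-leaf , refl) rewrite u-leaf | isHub-hub = s≤s z≤n

    child≢ : ∀ {u v} → Parent u v → u ≢ other
    child≢ (u-leaf , _) refl = contradiction (trans (sym isHub-other) u-leaf) λ ()

    parent≢ : ∀ {u v} → Parent u v → v ≢ other
    parent≢ (_ , refl) = hub≢other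

    orphan : ∀ {u} → u ≢ other → u ≡ hub ⊎ ∃[ v ] Parent u v
    orphan {u} u≢ with isHub u in eq
    ... | true  = inj₁ (hubs eq u≢)
    ... | false = inj₂ (hub , refl , refl)

    hub≢leaf : ∀ {u v} → Parent u v → isHub u ≢ isHub v
    hub≢leaf (u-leaf , refl) eq = contradiction (trans (sym u-leaf) (trans eq isHub-hub)) λ ()

    rainbow : ∀ {u v x y} → Parent u v → Parent x y → col u v ≡ col x y → u ≡ x
    rainbow {leaf i} {x = leaf j} (refl , refl) (refl , refl) eq = cong (λ j → leaf j) (col-injective eq)

    rainbowTree : RainbowTree χ (∁ ⁅ other ⁆)
    rainbowTree = RootedTree.rainbowTree χ other hub parent?
      (λ (_ , eq) (_ , eq′) → trans eq (sym eq′)) rank descends hub≢other child≢ parent≢ orphan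
      (λ p → adj⁺ (hub≢leaf p)) rainbow

  module BroomTree (i : Fin k) where

    Parent : Vertex → Vertex → Set
    Parent u v = (isHub u ≡ false × u ≢ leaf i × v ≡ b) ⊎ (u ≡ a × v ≡ leaf (ρ i))

    -- The broom is rooted at `b`, with `a` hanging below the leaf `leaf (ρ i)`; this gives the
    -- ranks 0, 1 and 2.
    parent? : Decidable Parent
    parent? u v = ((isHub u Bool.≟ false) ×-dec ¬? (u Fin.≟ leaf i) ×-dec (v Fin.≟ b))
      ⊎-dec ((u Fin.≟ a) ×-dec (v Fin.≟ leaf (ρ i)))

    functional : ∀ {u v w} → Parent u v → Parent u w → v ≡ w
    functional (inj₁ (_ , _ , refl)) (inj₁ (_ , _ , refl)) = refl
    functional (inj₁ (() , _))       (inj₂ (refl , _))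
    functional (inj₂ (refl , _))     (inj₁ (() , _))
    functional (inj₂ (_ , refl))     (inj₂ (_ , refl))     = refl

    rank : Vertex → ℕ
    rank a        = 2
    rank b        = 0
    rank (leaf _) = 1

    descends : ∀ {u v} → Parent u v → rank v < rank u
    descends {leaf _} (inj₁ (_ , _ , refl)) = s≤s z≤n
    descends          (inj₂ (refl , refl))  = s≤s (s≤s z≤n)

    child≢ : ∀ {u v} → Parent u v → u ≢ leaf i
    child≢ (inj₁ (_ , u≢ , _)) = u≢
    child≢ (inj₂ (refl , _))   = λ ()

    parent≢ : ∀ {u v} → Parent u v → v ≢ leaf i
    parent≢ (inj₁ (_ , _ , refl)) = λ ()
    -- Here fixed points of `ρ` must be excluded: `a` has to hang at a leaf other than the deleted
    -- one.
    parent≢ (inj₂ (_ , refl)) eq  = ρ-derangement i (Fin.suc-injective (Fin.suc-injective eq))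

    orphan : ∀ {u} → u ≢ leaf i → u ≡ b ⊎ ∃[ v ] Parent u v
    orphan {a}      _  = inj₂ (_ , inj₂ (refl , refl))
    orphan {b}      _  = inj₁ refl
    orphan {leaf j} u≢ = inj₂ (_ , inj₁ (refl , u≢ , refl))

    hub≢leaf : ∀ {u v} → Parent u v → isHub u ≢ isHub v
    hub≢leaf {leaf _} (inj₁ (_ , _ , refl)) = λ ()
    hub≢leaf          (inj₂ (refl , refl))  = λ ()

    rainbow : ∀ {u v x y} → Parent u v → Parent x y → col u v ≡ col x y → u ≡ x
    rainbow {leaf _} {x = leaf _} (inj₁ (_ , _ , refl)) (inj₁ (_ , _ , refl)) eq =
      cong (λ j → leaf j) (ρ-injective eq)
    -- The handle has color `ρ i`, which at `b` occurs only on the edge to the deleted `leaf i`.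
    rainbow {leaf _} (inj₁ (_ , u≢ , refl)) (inj₂ (refl , refl)) eq =
      contradiction (cong (λ j → leaf j) (ρ-injective eq)) u≢
    rainbow {x = leaf _} (inj₂ (refl , refl)) (inj₁ (_ , x≢ , refl)) eq =
      contradiction (cong (λ j → leaf j) (ρ-injective (sym eq))) x≢
    rainbow (inj₂ (refl , _)) (inj₂ (refl , _)) _ = refl

    rainbowTree : RainbowTree χ (∁ ⁅ leaf i ⁆)
    rainbowTree = RootedTree.rainbowTree χ (leaf i) b parent? functional rank descends
      (λ ()) child≢ parent≢ orphan (λ p → adj⁺ (hub≢leaf p)) rainbow

  rainbowTree : ∀ x → RainbowTree χ (∁ ⁅ x ⁆)
  rainbowTree a = StarTree.rainbowTree b a refl refl (λ ())
    (λ { {a} _ u≢ → contradiction refl u≢ ; {b} _ _ → refl }) ρ-injective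
  rainbowTree b = StarTree.rainbowTree a b refl refl (λ ())
    (λ { {a} _ _ → refl ; {b} _ u≢ → contradiction refl u≢ }) id
  rainbowTree (leaf i) = BroomTree.rainbowTree i

  isRainbowColoring : IsRainbowColoring (1 + k) χ
  isRainbowColoring S eq with ⊆∁⁅⁆ S (ℕ.≤-reflexive (cong suc eq))
  ... | x , S⊆ with rainbowTree x
  ...   | T , tree , rainbow , covers = T , tree , rainbow , covers ∘ S⊆

  -- Both hubs precede all leaves in the order on `Fin`, so every listed edge is a pair of a hub
  -- followed by a leaf.
  size≤ : size K ≤ 2 * k
  size≤ = subst (size K ≤_) length≡ (unique-⊆⇒length≤ (edges-unique K) λ e∈ →
    let u<v , p = ∈edges⁻ K e∈ in spoke u<v (adj⁻ p))
    where
    hubs : List Vertex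
    hubs = a ∷ b ∷ []

    leaves : List Vertex
    leaves = map (λ j → leaf j) (allFin k)

    spokes : List (Vertex × Vertex)
    spokes = cartesianProduct hubs leaves

    length≡ : length spokes ≡ 2 * k
    length≡ = trans (length-cartesianProductWith _,_ hubs leaves)
      (cong (2 *_) (trans (length-map _ (allFin k)) (length-allFin k)))

    leaf∈ : ∀ j → leaf j ∈ leaves
    leaf∈ j = ∈-map⁺ (λ j → leaf j) (∈-allFin j)

    spoke : ∀ {u v} → u Fin.< v → isHub u ≢ isHub v → (u , v) ∈ spokes
    spoke {a}      {leaf j} _ _  = ∈-cartesianProduct⁺ {xs = hubs} (here refl) (leaf∈ j)
    spoke {b}      {leaf j} _ _  = ∈-cartesianProduct⁺ {xs = hubs} (there (here refl)) (leaf∈ j)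
    spoke {a}      {a}      _ ne = contradiction refl ne
    spoke {a}      {b}      _ ne = contradiction refl ne
    spoke {b}      {b}      _ ne = contradiction refl ne
    spoke {leaf _} {leaf _} _ ne = contradiction refl ne
    spoke {leaf _} {b}      (s≤s ())

-- The minimum size.

theorem2p15 : (n : ℕ) → 4 ≤ n →
    ∃[ m ] IsT n (n ∸ 1) (n ∸ 2) m × m ≤ 2 * n ∸ 4
theorem2p15 (suc (suc (suc (suc m)))) (s≤s (s≤s (s≤s (s≤s z≤n)))) =
  size K , ((K , connected , (k , isRx , ℕ.≤-refl) , refl) , minimal) , size≤′
  where
  open Extremal m

  isRx : IsRx (1 + k) K k
  -- The general bound on colors, applied to `K` itself, shows that its rainbow index is exactly
  -- `k`.
  isRx = (χ , isRainbowColoring) , λ _ (χ′ , χ′-rainbow) → rainbow⇒colors≥ χ′ χ′-rainbow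

  size≤′ : size K ≤ 2 * (2 + k) ∸ 4
  size≤′ = subst (size K ≤_)
    (sym (trans (cong (_∸ 4) (ℕ.*-distribˡ-+ 2 2 k)) (ℕ.m+n∸m≡n 4 (2 * k)))) size≤

  minimal : ∀ j → (Σ[ G ∈ Graph (2 + k) ] Connected G × (∃[ r ] IsRx (1 + k) G r × r ≤ k) × size G ≡ j) →
    size K ≤ j
  -- The upper bound for `K` and the lower bound for any competitor `G` meet at `2 * k`, so `size K`
  -- is the minimum itself.
  minimal _ (G , _ , (r , ((χ′ , χ′-rainbow) , _) , r≤k) , refl) = begin
    size K  ≤⟨ size≤ ⟩
    2 * k   ≡⟨ ℕ.*-comm 2 k ⟩
    k * 2   ≤⟨ rainbow⇒size≥ χ′ χ′-rainbow r≤k ⟩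
    size G  ∎
    where open ℕ.≤-Reasoning
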